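{- If $\mathscr{C}$ is a positive variety, then $(\mathscr{C}\circ\mathsf{SU})\circ\mathsf{MOD}=[\mathscr{C}\circ\mathsf{SU}]$.
   Context: A class of languages $\mathscr{C}$ assigns to every alphabet $A$ a set $\mathscr{C}(A)$ of regular languages over $A$. A positive variety is a class in which each $\mathscr{C}(A)$ contains $\emptyset,A^*$, is closed under finite unions and intersections and under quotients $u^{ -1}L=\{v\mid uv\in L\}$, $Lu^{ -1}=\{v\mid vu\in L\}$, and which is closed under inverse images of all monoid morphisms $A^*\to B^*$. Enrichment: for a finite partition $\mathbf{P}$ of $A^*$, $[u]_{\mathbf{P}}$ is the block containing $u$; $\tau_{\mathbf{P}}:A^*\to(\mathbf{P}\times A)^*$ maps $a_1\cdots a_n$ to $b_1\cdots b_n$ with $b_i=([a_1\cdots a_{i-1}]_{\mathbf{P}},a_i)$, $\tau_{\mathbf{P}}(\varepsilon)=\varepsilon$. $(\mathscr{C}\circ\mathscr{D})(A)$ is the set of $L\subseteq A^*$ such that for some finite partition $\mathbf{P}$ of $A^*$ into languages of $\mathscr{D}(A)$ there are $L_P\in\mathscr{C}(\mathbf{P}\times A)$ with $L=\bigcup_{P\in\mathbf{P}}(\tau_{\mathbf{P}}^{ -1}(L_P)\cap P)$. $\mathsf{MOD}(A)$: finite Boolean combinations of $\{w\mid |w|\equiv m\bmod d\}$ ($m<d$). $\mathsf{SU}(A)$: finite Boolean combinations of $A^*w$, $w\in A^*$. Block abstraction: for $d\ge1$, let $A_d$ be the finite alphabet whose letters are the nonempty words of $A^*$ of length at most $d$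 (a word $w$ used as a letter is written $(w)$). Define $\mu_d:A^*\to A_d^*$: write $|w|=dq+r$ with $0\le r<d$ and $w=w_1\cdots w_{q+1}$ with $|w_i|=d$ for $i\le q$ and $|w_{q+1}|=r$; then $\mu_d(w)=(w_1)\cdots(w_q)$ if $r=0$ and $\mu_d(w)=(w_1)\cdots(w_q)(w_{q+1})$ otherwise. $[\mathscr{C}]_d(A)=\{\mu_d^{ -1}(K)\mid K\in\mathscr{C}(A_d)\}$ and $[\mathscr{C}](A)=\bigcup_{d\ge1}[\mathscr{C}]_d(A)$. -}

module Defs where

open import Data.Nat using (ℕ; zero; suc; _+_; _*_; _<_)
open import Data.Fin using (Fin; toℕ) renaming (zero to fzero; suc to fsuc)
open import Data.Vec using (Vec; _∷_; [])
open import Data.List using (List; []; _∷_; _++_; [_]; length; concatMap)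
open import Data.Bool using (Bool; true)
open import Data.Product using (Σ; _×_; _,_; ∃)
open import Data.Empty using (⊥)
open import Data.Unit using (⊤)
open import Data.Sum using (_⊎_)
open import Relation.Nullary using (¬_)
open import Relation.Binary.PropositionalEquality using (_≡_)
open import Function.Bundles using (_⇔_; _↔_)

Finite : Set → Set
Finite A = Σ ℕ λ k → Fin k ↔ A

Lang : Set → Set₁
Lang A = List A → Set

_≐_ : {A : Set} → Lang A → Lang A → Set
L ≐ L' = ∀ u → L u ⇔ L' u

record DFA (A : Set) : Set where
  field
    states : ℕ
    δ      : Fin states → A → Fin states
    init   : Fin states
    final  : Fin states → Bool

run : {A : Set} (M : DFA A) → Fin (DFA.states M) → List A → Fin (DFA.states M)
run M q []      = q
run M q (a ∷ w) = run M (DFA.δ M q a) w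

Regular : {A : Set} → Lang A → Set
Regular {A} L = Σ (DFA A) λ M → ∀ u → L u ⇔ (DFA.final M (run M (DFA.init M) u) ≡ true)

Class : Set₂
Class = (A : Set) → Lang A → Set₁

record PositiveVariety (C : Class) : Set₂ where
  field
    regular   : ∀ {A} → Finite A → ∀ L → C A L → Regular L
    -- languages are sets: membership respects equality of languages
    respects  : ∀ {A} → Finite A → ∀ {L L'} → C A L → L ≐ L' → C A L'
    empty     : ∀ {A} → Finite A → C A (λ _ → ⊥)
    full      : ∀ {A} → Finite A → C A (λ _ → ⊤)
    union     : ∀ {A} → Finite A → ∀ {L L'} → C A L → C A L' → C A (λ u → L u ⊎ L' u)
    inter     : ∀ {A} → Finite A → ∀ {L L'} → C A L → C A L' → C A (λ u → L u × L' u)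
    quotˡ     : ∀ {A} → Finite A → ∀ {L} → C A L → (u : List A) → C A (λ v → L (u ++ v))
    quotʳ     : ∀ {A} → Finite A → ∀ {L} → C A L → (u : List A) → C A (λ v → L (v ++ u))
    -- a monoid morphism A* → B* is determined by its values h on letters
    inverse   : ∀ {A B} → Finite A → Finite B → ∀ {L} → C B L →
                (h : A → List B) → C A (λ u → L (concatMap h u))

data BExpr (G : Set) : Set where
  atom  : G → BExpr G
  none  : BExpr G
  all   : BExpr G
  compl : BExpr G → BExpr G
  _∪ₑ_  : BExpr G → BExpr G → BExpr G
  _∩ₑ_  : BExpr G → BExpr G → BExpr G

⟦_⟧ : {A G : Set} → BExpr G → (G → Lang A) → Lang A
⟦ atom g ⟧ σ u  = σ g u
⟦ none ⟧ σ u    = ⊥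
⟦ all ⟧ σ u     = ⊤
⟦ compl e ⟧ σ u = ¬ (⟦ e ⟧ σ u)
⟦ e ∪ₑ f ⟧ σ u  = ⟦ e ⟧ σ u ⊎ ⟦ f ⟧ σ u
⟦ e ∩ₑ f ⟧ σ u  = ⟦ e ⟧ σ u × ⟦ f ⟧ σ u

record ModAtom : Set where
  constructor modAtom
  field
    m d : ℕ
    m<d : m < d

modLang : {A : Set} → ModAtom → Lang A
modLang (modAtom m d _) w = ∃ λ q → length w ≡ m + q * d

data MOD (A : Set) (L : Lang A) : Set₁ where
  mkMOD : (e : BExpr ModAtom) → L ≐ ⟦ e ⟧ modLang → MOD A L

suLang : {A : Set} → List A → Lang A
suLang w u = ∃ λ v → u ≡ v ++ w

data SU (A : Set) (L : Lang A) : Set₁ where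
  mkSU : (e : BExpr (List A)) → L ≐ ⟦ e ⟧ suLang → SU A L

-- Enrichment C ∘ D
-- A finite partition P of A* with k blocks is a surjection p : A* → Fin k;
-- block i is {u | p u ≡ i}.  The alphabet P × A is Fin k × A.

τ-from : {A : Set} {k : ℕ} → (List A → Fin k) → List A → List A → List (Fin k × A)
τ-from p pre []      = []
τ-from p pre (a ∷ w) = (p pre , a) ∷ τ-from p (pre ++ [ a ]) w

τ : {A : Set} {k : ℕ} → (List A → Fin k) → List A → List (Fin k × A)
τ p = τ-from p []

record Enriched (C D : Class) (A : Set) (L : Lang A) : Set₁ where
  field
    k        : ℕ
    p        : List A → Fin k
    blocksD  : ∀ i → D A (λ u → p u ≡ i)
    nonempty : ∀ i → ∃ λ u → p u ≡ i
    Lp       : Fin k → Lang (Fin k × A)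
    LpC      : ∀ i → C (Fin k × A) (Lp i)
    decomp   : L ≐ (λ u → ∃ λ i → Lp i (τ p u) × p u ≡ i)

_∘ᶜ_ : Class → Class → Class
(C ∘ᶜ D) A L = Enriched C D A L

-- Block abstraction
-- For d = suc d', the letters of A_d are nonempty words of length ≤ d,
-- encoded as (l , v) with l : Fin d and v a word of length l + 1.

Block : Set → ℕ → Set
Block A d' = Σ (Fin (suc d')) λ l → Vec A (suc (toℕ l))

takeBlock : {A : Set} (d' : ℕ) → A → List A → Block A d' × List A
takeBlock zero     a rest       = ((fzero , a ∷ []) , rest)
takeBlock (suc d') a []         = ((fzero , a ∷ []) , [])
takeBlock (suc d') a (b ∷ rest) with takeBlock d' b rest
... | ((l , v) , r) = ((fsuc l , a ∷ v) , r)

blocks : {A : Set} (d' : ℕ) → ℕ → List A → List (Block A d')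
blocks d' zero    w       = []
blocks d' (suc f) []      = []
blocks d' (suc f) (a ∷ w) with takeBlock d' a w
... | (b , r) = b ∷ blocks d' f r

-- μ_d for d = suc d' (fuel length w suffices)
μ : {A : Set} (d' : ℕ) → List A → List (Block A d')
μ d' w = blocks d' (length w) w

-- [C](A) = ⋃_{d ≥ 1} [C]_d(A), with d = suc d'
data BlockAbs (C : Class) (A : Set) (L : Lang A) : Set₁ where
  mkBA : (d' : ℕ) (K : Lang (Block A d')) → C (Block A d') K →
         L ≐ (λ u → K (μ d' u)) → BlockAbs C A L

{-# OPTIONS --safe #-}
-- A partition into SU languages is one whose classes are determined by a suffix of bounded length,
-- and a partition into MOD languages is one whose classes are determined by the length modulo some d.
--
-- From left to right: if P is d-periodic, then τ_P(u) is the image of μ_d(u) under the nonerasing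
-- morphism sending a block w to τ_P(w), and C ∘ SU is closed under inverse images of nonerasing
-- morphisms because a suffix of N blocks determines a suffix of at least N letters. The class of u
-- in P is that of its last block.
--
-- From right to left: knowing the length modulo d, an erasing morphism emits a block at every
-- position that ends one. That block, and the suffix class (over blocks) of what precedes it, are
-- read off the suffix of u of n d + (|u| mod d) letters, which starts at a block boundary. A last
-- incomplete block is a fixed letter once the length and suffix classes of u are known, so it is
-- accounted for by a right quotient.

module Submission where

open import Defs
open import Data.Empty using (⊥-elim)
open import Data.Fin using (Fin; toℕ; fromℕ<; combine; remQuot) renaming (zero to fzero; suc to fsuc)
open import Data.Fin.Properties as Fin
  using (toℕ-fromℕ<; toℕ<n; *↔×; +↔⊎; remQuot-combine; combine-remQuot)
open import Data.List
  using (List; []; _∷_; _++_; [_]; length; concatMap; map; drop; take; reverse; replicate)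
open import Data.List.Properties
open import Data.List.Relation.Unary.All using (All; []; _∷_)
import Data.List.Relation.Unary.All.Properties as All
open import Data.List.Reverse using (Reverse; []; _∶_∶ʳ_; reverseView)
open import Data.Nat using (ℕ; NonZero; zero; suc; _+_; _*_; _∸_; _≤_; _<_; _⊔_; _≟_; z≤n; s≤s; s≤s⁻¹)
open import Data.Nat.DivMod
open import Data.Nat.Divisibility using (_∣_; m∣m*n; n∣m*n)
open import Data.Nat.Properties hiding (_≟_)
open import Data.Product using (Σ; _×_; _,_; ∃; proj₁; proj₂)
open import Data.Product.Function.NonDependent.Propositional using (_×-⇔_; _×-↔_)
open import Data.Sum as Sum using (_⊎_; inj₁; inj₂)
open import Data.Sum.Function.Propositional using (_⊎-⇔_; _⊎-↔_)
open import Data.Unit using (⊤; tt)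
open import Data.Vec using (Vec; []; _∷_; toList; uncons)
open import Function using (_∘_; id)
open import Function.Bundles using (_⇔_; _↔_; mk⇔; mk↔ₛ′; Equivalence; Inverse)
open import Function.Properties.Inverse using (↔-trans; ↔-refl)
open import Relation.Binary.PropositionalEquality hiding ([_])
open import Relation.Nullary using (¬_; Dec; yes; no)

open Equivalence using (to; from)
open ≡-Reasoning

private variable
  A B X Y : Set
  d k n : ℕ

-- Finite types

Finite-Fin : Finite (Fin k)
Finite-Fin = _ , ↔-refl

Finite-× : Finite A → Finite B → Finite (A × B)
Finite-× (_ , φ) (_ , ψ) = _ , ↔-trans *↔× (φ ×-↔ ψ)

Finite-⊎ : Finite A → Finite B → Finite (A ⊎ B)
Finite-⊎ (_ , φ) (_ , ψ) = _ , ↔-trans +↔⊎ (φ ⊎-↔ ψ)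

Finite-↔ : Finite A → A ↔ B → Finite B
Finite-↔ (_ , φ) ψ = _ , ↔-trans φ ψ

Finite-Vec : Finite A → ∀ n → Finite (Vec A n)
Finite-Vec fin zero    = 1 , mk↔ₛ′ (λ _ → []) (λ _ → fzero) (λ { [] → refl }) unique
  where
  unique : (i : Fin 1) → fzero ≡ i
  unique fzero = refl
Finite-Vec fin (suc n) = Finite-↔ (Finite-× fin (Finite-Vec fin n))
  (mk↔ₛ′ (λ (a , v) → a ∷ v) uncons (λ { (_ ∷ _) → refl }) (λ _ → refl))

Finite-Σ : {P : Fin n → Set} → (∀ i → Finite (P i)) → Finite (Σ (Fin n) P)
Finite-Σ {zero}  fin = 0 , mk↔ₛ′ (λ ()) (λ ()) (λ ()) (λ ())
Finite-Σ {suc n} fin = Finite-↔ (Finite-⊎ (fin fzero) (Finite-Σ (fin ∘ fsuc)))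
  (mk↔ₛ′ (λ { (inj₁ x) → fzero , x ; (inj₂ (i , x)) → fsuc i , x })
         (λ { (fzero , x) → inj₁ x ; (fsuc i , x) → inj₂ (i , x) })
         (λ { (fzero , _) → refl ; (fsuc _ , _) → refl })
         (λ { (inj₁ _) → refl ; (inj₂ _) → refl }))

Finite-Block : Finite A → ∀ d → Finite (Block A d)
Finite-Block fin d = Finite-Σ (λ l → Finite-Vec fin _)

-- Partitions into Boolean combinations

-- The relations `R n` become finer as indices are joined, and `SharesSuffix` is an instance that is
-- not symmetric. Membership is transported in both directions because complement exchanges them.
module Invariance {A G : Set} (σ : G → Lang A) (R : ℕ → List A → List A → Set)
  (join : ∀ m n → ∃ λ o → ∀ {u v} → R o u v → R m u v × R n u v)
  (atomic : ∀ g → ∃ λ n → ∀ {u v} → R n u v → σ g u ⇔ σ g v) where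

  ⟦⟧-invariant : ∀ e → ∃ λ n → ∀ {u v} → R n u v → ⟦ e ⟧ σ u ⇔ ⟦ e ⟧ σ v
  ⟦⟧-invariant (atom g) = atomic g
  ⟦⟧-invariant none     = 0 , λ _ → mk⇔ id id
  ⟦⟧-invariant all      = 0 , λ _ → mk⇔ id id
  ⟦⟧-invariant (compl e) with ⟦⟧-invariant e
  ... | n , inv = n , λ r → mk⇔ (_∘ from (inv r)) (_∘ to (inv r))
  ⟦⟧-invariant (e ∪ₑ f) with ⟦⟧-invariant e | ⟦⟧-invariant f
  ... | m , inv | n , inv' with join m n
  ... | o , j = o , λ r → inv (proj₁ (j r)) ⊎-⇔ inv' (proj₂ (j r))
  ⟦⟧-invariant (e ∩ₑ f) with ⟦⟧-invariant e | ⟦⟧-invariant f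
  ... | m , inv | n , inv' with join m n
  ... | o , j = o , λ r → inv (proj₁ (j r)) ×-⇔ inv' (proj₂ (j r))

  join-family : (f : Fin k → ℕ) → ∃ λ o → ∀ i {u v} → R o u v → R (f i) u v
  join-family {zero}  f = 0 , λ ()
  join-family {suc k} f with join-family (f ∘ fsuc)
  ... | m , below with join (f fzero) m
  ... | o , j = o , λ { fzero r → proj₁ (j r) ; (fsuc i) r → below i (proj₂ (j r)) }

  -- Testing the single block of `v` is enough: `v` lies in it, hence so does the related word `u`.
  partition-invariant : (p : List A → Fin k) (e : Fin k → BExpr G) →
    (∀ i → (λ u → p u ≡ i) ≐ ⟦ e i ⟧ σ) → ∃ λ n → ∀ {u v} → R n u v → p u ≡ p v
  partition-invariant p e block with join-family (λ i → proj₁ (⟦⟧-invariant (e i)))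
  ... | n , below = n , λ {u} {v} r → from (block (p v) u)
          (from (proj₂ (⟦⟧-invariant (e (p v))) (below (p v) r)) (to (block (p v) v) refl))

-- Functions determined by suffixes of bounded length

-- Only prefixing to a word of length at least `n` is constrained; each shorter word may have a
-- value of its own.
SufDet : {Y : Set} → ℕ → (List A → Y) → Set
SufDet n f = ∀ u w → n ≤ length w → f (u ++ w) ≡ f w

SufDet-≤ : ∀ {m n} {f : List A → Y} → m ≤ n → SufDet m f → SufDet n f
SufDet-≤ m≤n det u w n≤w = det u w (≤-trans m≤n n≤w)

SufDet-∘ : ∀ {f : List A → X} (g : X → Y) → SufDet n f → SufDet n (g ∘ f)
SufDet-∘ g det u w n≤w = cong g (det u w n≤w)

SufDet-++ : ∀ {f : List A → Y} (v : List A) → SufDet n f → SufDet n (λ u → f (u ++ v))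
SufDet-++ {f = f} v det u w n≤w = trans (cong f (++-assoc u w v))
  (det u (w ++ v) (≤-trans n≤w (length-++-≤ˡ w)))

SufDet-map : ∀ {f : List X → Y} (h : A → X) → SufDet n f → SufDet n (f ∘ map h)
SufDet-map {f = f} h det u w n≤w = trans (cong f (map-++ h u w))
  (det (map h u) (map h w) (≤-trans n≤w (≤-reflexive (sym (length-map h w)))))

-- Truncated subtraction makes this the whole word when `u` has fewer than `n` letters.
suffix : ℕ → List A → List A
suffix n u = drop (length u ∸ n) u

drop-length-++ : (u w : List A) (c : ℕ) → drop (length u + c) (u ++ w) ≡ drop c w
drop-length-++ []      w c = refl
drop-length-++ (_ ∷ u) w c = drop-length-++ u w c

SufDet-suffix : ∀ n → SufDet {A = A} n (suffix n)
SufDet-suffix n u w n≤w = begin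
  drop (length (u ++ w) ∸ n) (u ++ w)        ≡⟨ cong (λ l → drop (l ∸ n) (u ++ w)) (length-++ u) ⟩
  drop (length u + length w ∸ n) (u ++ w)    ≡⟨ cong (λ l → drop l (u ++ w)) (+-∸-assoc (length u) n≤w) ⟩
  drop (length u + (length w ∸ n)) (u ++ w)  ≡⟨ drop-length-++ u w _ ⟩
  suffix n w ∎

SufDet-suffix-≡ : ∀ {f : List A → Y} → SufDet n f → ∀ u → f (suffix n u) ≡ f u
SufDet-suffix-≡ {n = n} {f} det u with ≤-total n (length u)
... | inj₁ n≤u = trans
      (sym (det (take (length u ∸ n) u) (suffix n u)
        (≤-reflexive (sym (trans (length-drop (length u ∸ n) u) (m∸[m∸n]≡n n≤u))))))
      (cong f (take++drop≡id (length u ∸ n) u))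
... | inj₂ u≤n = cong (λ c → f (drop c u)) (m≤n⇒m∸n≡0 u≤n)

-- Both prefixes are stripped in parallel. If `z` ran out first, `w` would be strictly longer than
-- `v`.
++-cancel-longer : (t z : List A) {v w : List A} → length w ≤ length v → t ++ v ≡ z ++ w → suLang w v
++-cancel-longer []      z       w≤v eq = z , eq
++-cancel-longer (c ∷ t) []      {v} w≤v eq = ⊥-elim (1+n≰n
  (≤-trans (s≤s (length-++-≤ʳ v {t})) (≤-trans (≤-reflexive (cong length eq)) w≤v)))
++-cancel-longer (c ∷ t) (_ ∷ z) w≤v eq = ++-cancel-longer t z w≤v (∷-injectiveʳ eq)

SharesSuffix : ℕ → List A → List A → Set
SharesSuffix n u v = n ≤ length v × ∃ λ t → u ≡ t ++ v

SharesSuffix-join : ∀ m n → ∃ λ o → ∀ {u v : List A} → SharesSuffix o u v → SharesSuffix m u v × SharesSuffix n u v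
SharesSuffix-join m n = m ⊔ n , λ (l , s) → (≤-trans (m≤m⊔n m n) l , s) , (≤-trans (m≤n⊔m m n) l , s)

suLang-invariant : (w : List A) → ∃ λ n → ∀ {u v} → SharesSuffix n u v → suLang w u ⇔ suLang w v
suLang-invariant w = length w , λ { (l , t , refl) → mk⇔
  (λ (z , eq) → ++-cancel-longer t z l eq)
  (λ { (z , refl) → t ++ z , sym (++-assoc t z w) }) }

module SUInvariance {A : Set} = Invariance {A} suLang SharesSuffix SharesSuffix-join suLang-invariant

SU-blocks⇒SufDet : (p : List A → Fin k) → (∀ i → SU A (λ u → p u ≡ i)) → ∃ λ n → SufDet n p
SU-blocks⇒SufDet p blk
  with SUInvariance.partition-invariant p (λ i → expr (blk i)) (λ i → correct (blk i))
  where
  expr : ∀ {L} → SU _ L → BExpr _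
  expr (mkSU e _) = e
  correct : ∀ {L} (s : SU _ L) → L ≐ ⟦ expr s ⟧ suLang
  correct (mkSU _ c) = c
... | n , inv = n , λ u w n≤w → inv (n≤w , u , refl)

-- Boolean expressions for classes determined by suffixes

⋃ₑ : {G : Set} → (Fin k → BExpr G) → BExpr G
⋃ₑ {zero}  e = none
⋃ₑ {suc k} e = e fzero ∪ₑ ⋃ₑ (e ∘ fsuc)

⋃ₑ-correct : {G : Set} (σ : G → Lang A) (e : Fin k → BExpr G) →
  ⟦ ⋃ₑ e ⟧ σ ≐ (λ u → ∃ λ i → ⟦ e i ⟧ σ u)
⋃ₑ-correct {k = zero}  σ e u = mk⇔ (λ ()) (λ ())
⋃ₑ-correct {k = suc k} σ e u = mk⇔
  (λ { (inj₁ x) → fzero , x ; (inj₂ y) → let i , z = to (⋃ₑ-correct σ (e ∘ fsuc) u) y in fsuc i , z })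
  (λ { (fzero , x) → inj₁ x ; (fsuc i , z) → inj₂ (from (⋃ₑ-correct σ (e ∘ fsuc) u) (i , z)) })

onlyIf : {P G : Set} → Dec P → BExpr G → BExpr G
onlyIf (yes _) e = e
onlyIf (no _)  e = none

onlyIf-correct : {P G : Set} (σ : G → Lang A) (P? : Dec P) (e : BExpr G) →
  ⟦ onlyIf P? e ⟧ σ ≐ (λ u → ⟦ e ⟧ σ u × P)
onlyIf-correct σ (yes p) e u = mk⇔ (_, p) proj₁
onlyIf-correct σ (no ¬p) e u = mk⇔ (λ ()) (⊥-elim ∘ ¬p ∘ proj₂)

suLang-∷ : ∀ {a : A} {w u} → suLang (a ∷ w) u → suLang w u
suLang-∷ {a = a} {w} (v , eq) = v ++ [ a ] , trans eq (sym (++-assoc v [ a ] w))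

suLang-cases : ∀ {w u : List A} → suLang w u → u ≡ w ⊎ ∃ λ a → suLang (a ∷ w) u
suLang-cases {w = w} (v , eq) with reverseView v
... | []           = inj₁ eq
... | v' ∶ _ ∶ʳ a = inj₂ (a , v' , trans eq (++-assoc v' [ a ] w))

¬suLang-∷-self : ∀ {a : A} {w} → ¬ suLang (a ∷ w) w
¬suLang-∷-self {w = w} (v , eq) = 1+n≰n (≤-trans (length-++-≤ʳ (_ ∷ w) {v}) (≤-reflexive (cong length (sym eq))))

module SUExpr {A : Set} (fin : Finite A) (p : List A → Fin k) (i : Fin k) where
  open Inverse (proj₂ fin) using (strictlyInverseˡ) renaming (to to letter; from to index)

  -- The words of class i with suffix w: w itself or those with a longer suffix a ∷ w; once w is long
  -- enough to determine the class, A*w altogether.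
  classExpr : ℕ → List A → BExpr (List A)
  classExpr zero    w = onlyIf (p w Fin.≟ i) (atom w)
  classExpr (suc n) w =
    onlyIf (p w Fin.≟ i) (atom w ∩ₑ compl (⋃ₑ (λ j → atom (letter j ∷ w)))) ∪ₑ
    ⋃ₑ (λ j → classExpr n (letter j ∷ w))

  -- The threshold `n + length w` stays constant through the recursion: each step spends one unit of
  -- `n` and adds one letter to `w`. At `zero` the suffix `w` alone fixes the class.
  classExpr-correct : ∀ n w → SufDet (n + length w) p →
    ⟦ classExpr n w ⟧ suLang ≐ (λ u → suLang w u × p u ≡ i)
  classExpr-correct zero w det u = mk⇔
    (λ x → let (v , eq) , pw = to (onlyIf-correct suLang (p w Fin.≟ i) (atom w) u) x in
           (v , eq) , trans (trans (cong p eq) (det v w ≤-refl)) pw)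
    (λ ((v , eq) , pu) → from (onlyIf-correct suLang (p w Fin.≟ i) (atom w) u)
           ((v , eq) , trans (trans (sym (det v w ≤-refl)) (cong p (sym eq))) pu))
  classExpr-correct (suc n) w det u = mk⇔ ⇒ ⇐
    where
    longer : Fin (proj₁ fin) → BExpr (List A)
    longer j = atom (letter j ∷ w)
    rec : ∀ j → ⟦ classExpr n (letter j ∷ w) ⟧ suLang u ⇔ (suLang (letter j ∷ w) u × p u ≡ i)
    rec j = classExpr-correct n (letter j ∷ w) (subst (λ m → SufDet m p) (sym (+-suc n (length w))) det) u
    ⇒ : _ → suLang w u × p u ≡ i
    ⇒ (inj₁ x) with to (onlyIf-correct suLang (p w Fin.≟ i) (atom w ∩ₑ compl (⋃ₑ longer)) u) x
    ... | (s , ¬l) , pw with suLang-cases s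
    ... | inj₁ u≡w     = s , trans (cong p u≡w) pw
    ... | inj₂ (a , t) = ⊥-elim (¬l (from (⋃ₑ-correct suLang longer u)
          (index a , subst (λ b → suLang (b ∷ w) u) (sym (strictlyInverseˡ a)) t)))
    ⇒ (inj₂ y) with to (⋃ₑ-correct suLang (λ j → classExpr n (letter j ∷ w)) u) y
    ... | j , z = let s , pu = to (rec j) z in suLang-∷ s , pu
    ⇐ : suLang w u × p u ≡ i → _
    ⇐ (s , pu) with suLang-cases s
    ... | inj₁ refl    = inj₁ (from (onlyIf-correct suLang (p w Fin.≟ i) (atom w ∩ₑ compl (⋃ₑ longer)) w)
                           ((s , λ x → ¬suLang-∷-self (proj₂ (to (⋃ₑ-correct suLang longer w) x))) , pu))
    ... | inj₂ (a , t) = inj₂ (from (⋃ₑ-correct suLang (λ j → classExpr n (letter j ∷ w)) u)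
          (index a , from (rec (index a)) (subst (λ b → suLang (b ∷ w) u) (sym (strictlyInverseˡ a)) t , pu)))

SufDet⇒SU-blocks : Finite A → (p : List A → Fin k) → SufDet n p → ∀ i → SU A (λ u → p u ≡ i)
SufDet⇒SU-blocks {n = n} fin p det i = mkSU (classExpr n []) λ u →
  let c = classExpr-correct n [] (subst (λ m → SufDet m p) (sym (+-identityʳ n)) det) u in
  mk⇔ (λ pu → from c ((u , sym (++-identityʳ u)) , pu)) (proj₂ ∘ to c)
  where open SUExpr fin p i

-- The partition by suffixes of bounded length

record SuffixPartition (A : Set) (n : ℕ) : Set₁ where
  field
    size       : ℕ
    class      : List A → Fin size
    word       : Fin size → List A
    determined : SufDet n class
    class-word : ∀ i → class (word i) ≡ i
    -- This lets a morphism compute with its context: whatever depends only on a suffix of length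
    -- `n` can be evaluated on the representative of the class, which is all that a letter of the
    -- enriched alphabet carries.
    word-class : ∀ {Y : Set} {f : List A → Y} → SufDet n f → ∀ u → f (word (class u)) ≡ f u

module Prefixes {A : Set} (fin : Finite A) where
  open Inverse (proj₂ fin) using (strictlyInverseˡ; strictlyInverseʳ) renaming (to to letter; from to index)

  -- The number of words of length at most `n`: the empty word, or a first letter followed by a word
  -- of length at most `n - 1`.
  size : ℕ → ℕ
  size zero    = 1
  size (suc n) = suc (proj₁ fin * size n)

  encode : ∀ n → List A → Fin (size n)
  encode zero    u       = fzero
  encode (suc n) []      = fzero
  encode (suc n) (a ∷ u) = fsuc (combine (index a) (encode n u))

  decode : ∀ n → Fin (size n) → List A
  decode zero    i        = []
  decode (suc n) fzero    = []
  decode (suc n) (fsuc i) = let j , i' = remQuot (size n) i in letter j ∷ decode n i'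

  encode-decode : ∀ n i → encode n (decode n i) ≡ i
  encode-decode zero    fzero    = refl
  encode-decode (suc n) fzero    = refl
  encode-decode (suc n) (fsuc i) = cong fsuc (trans
    (cong₂ combine (strictlyInverseʳ _) (encode-decode n _)) (combine-remQuot {proj₁ fin} (size n) i))

  decode-encode : ∀ n u → decode n (encode n u) ≡ take n u
  decode-encode zero    u       = refl
  decode-encode (suc n) []      = refl
  decode-encode (suc n) (a ∷ u) = trans
    (cong (λ (j , i) → letter j ∷ decode n i) (remQuot-combine (index a) (encode n u)))
    (cong₂ _∷_ (strictlyInverseˡ a) (decode-encode n u))

  encode-++ : ∀ n u w → n ≤ length u → encode n (u ++ w) ≡ encode n u
  encode-++ zero    u       w n≤u       = refl
  encode-++ (suc n) (a ∷ u) w (s≤s n≤u) = cong (fsuc ∘ combine (index a)) (encode-++ n u w n≤u)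

suffixPartition : Finite A → ∀ n → SuffixPartition A n
suffixPartition {A} fin n = record
  { size       = size n
  ; class      = encode n ∘ reverse
  ; word       = reverse ∘ decode n
  ; determined = λ u w n≤w → trans (cong (encode n) (reverse-++ u w))
      (encode-++ n (reverse w) (reverse u) (≤-trans n≤w (≤-reflexive (sym (length-reverse w)))))
  ; class-word = λ i → trans (cong (encode n) (reverse-involutive (decode n i))) (encode-decode n i)
  ; word-class = λ {Y} {f} det u → trans (cong (f ∘ reverse) (decode-encode n (reverse u)))
      (trans (prefix {f = f} det (reverse u)) (cong f (reverse-involutive u)))
  }
  where
  open Prefixes fin
  -- A word of length at most `n` is its own representative. A longer one, once reversed, ends in a
  -- suffix of exactly `n` letters, to which `det` applies.
  prefix : ∀ {Y : Set} {f : List A → Y} → SufDet n f → ∀ x → f (reverse (take n x)) ≡ f (reverse x)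
  prefix {f = f} det x with ≤-total n (length x)
  ... | inj₂ x≤n = cong (f ∘ reverse) (take-all n x x≤n)
  ... | inj₁ n≤x = trans
    (sym (det (reverse (drop n x)) (reverse (take n x)) (≤-reflexive (sym
      (trans (length-reverse (take n x)) (trans (length-take n x) (m≤n⇒m⊓n≡m n≤x)))))))
    (cong f (trans (sym (reverse-++ (take n x) (drop n x))) (cong reverse (take++drop≡id n x))))

-- Partitions by length

SameLength% : ℕ → List A → List A → Set
SameLength% d u v = length u % suc d ≡ length v % suc d

modLang-% : ∀ {m d} (m<d : m < suc d) (u : List A) →
  modLang (modAtom m (suc d) m<d) u ⇔ (length u % suc d ≡ m)
modLang-% {m = m} {d} m<d u = mk⇔
  (λ (q , eq) → trans (cong (_% suc d) eq) (trans ([m+kn]%n≡m%n m q (suc d)) (m<n⇒m%n≡m m<d)))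
  (λ { refl → length u / suc d , m≡m%n+[m/n]*n (length u) (suc d) })

%-coarsen : ∀ x y a b .{{_ : NonZero a}} .{{_ : NonZero b}} → a ∣ b → x % b ≡ y % b → x % a ≡ y % a
%-coarsen x y a b a∣b eq = begin
  x % a      ≡⟨ m∣n⇒o%n%m≡o%m a b x a∣b ⟨
  x % b % a  ≡⟨ cong (_% a) eq ⟩
  y % b % a  ≡⟨ m∣n⇒o%n%m≡o%m a b y a∣b ⟩
  y % a      ∎

SameLength%-join : ∀ m n → ∃ λ o → ∀ {u v : List A} → SameLength% o u v → SameLength% m u v × SameLength% n u v
-- The successor of this index is the product `suc m * suc n`, a common multiple of the two moduli.
SameLength%-join m n = n + m * suc n , λ {u} {v} r →
  %-coarsen (length u) (length v) (suc m) (suc m * suc n) (m∣m*n (suc n)) r ,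
  %-coarsen (length u) (length v) (suc n) (suc m * suc n) (n∣m*n (suc m)) r

modLang-invariant : ∀ g → ∃ λ n → ∀ {u v : List A} → SameLength% n u v → modLang g u ⇔ modLang g v
modLang-invariant (modAtom m (suc d) m<d) = d , λ {u} {v} r → mk⇔
  (from (modLang-% m<d v) ∘ trans (sym r) ∘ to (modLang-% m<d u))
  (from (modLang-% m<d u) ∘ trans r ∘ to (modLang-% m<d v))

module MODInvariance {A : Set} = Invariance {A} modLang SameLength% SameLength%-join modLang-invariant

MOD-blocks⇒periodic : (p : List A → Fin k) → (∀ i → MOD A (λ u → p u ≡ i)) →
  ∃ λ d → ∀ {u v} → SameLength% d u v → p u ≡ p v
MOD-blocks⇒periodic p blk =
  MODInvariance.partition-invariant p (λ i → expr (blk i)) (λ i → correct (blk i))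
  where
  expr : ∀ {L} → MOD _ L → BExpr _
  expr (mkMOD e _) = e
  correct : ∀ {L} (s : MOD _ L) → L ≐ ⟦ expr s ⟧ modLang
  correct (mkMOD _ c) = c

-- Residues need not all occur: over the empty alphabet the only block is {ε}.
record LengthPartition (A : Set) (d : ℕ) : Set₁ where
  field
    size     : ℕ
    class    : List A → Fin size
    residue  : Fin size → ℕ
    residue≤ : ∀ i → residue i ≤ d
    nonempty : ∀ i → ∃ λ u → class u ≡ i
    MOD-blocks : ∀ i → MOD A (λ u → class u ≡ i)
    residue-class : ∀ u → residue (class u) ≡ length u % suc d

lengthPartition : Finite A → ∀ d → LengthPartition A d
lengthPartition (zero , φ) d = record
  { size = 1
  ; class = λ _ → fzero
  ; residue = λ _ → 0
  ; residue≤ = λ _ → z≤n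
  ; nonempty = λ { fzero → [] , refl }
  ; MOD-blocks = λ { fzero → mkMOD all (λ _ → mk⇔ _ (λ _ → refl)) }
  ; residue-class = λ { [] → refl ; (a ∷ _) → ⊥-elim (Fin.¬Fin0 (Inverse.from φ a)) }
  }
lengthPartition {A} (suc _ , φ) d = record
  { size = suc d
  ; class = cls
  ; residue = toℕ
  ; residue≤ = λ i → s≤s⁻¹ (toℕ<n i)
  ; nonempty = λ i → replicate (toℕ i) (Inverse.to φ fzero) , Fin.toℕ-injective (trans (toℕ-fromℕ< _)
      (trans (cong (_% suc d) (length-replicate (toℕ i))) (m<n⇒m%n≡m (toℕ<n i))))
  ; MOD-blocks = λ i → mkMOD (atom (modAtom (toℕ i) (suc d) (toℕ<n i))) λ u → mk⇔
      (λ eq → from (modLang-% (toℕ<n i) u) (trans (sym (toℕ-fromℕ< _)) (cong toℕ eq)))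
      (λ x → Fin.toℕ-injective (trans (toℕ-fromℕ< _) (to (modLang-% (toℕ<n i) u) x)))
  ; residue-class = λ u → toℕ-fromℕ< _
  }
  where
  cls : List A → Fin (suc d)
  cls u = fromℕ< (m%n<n (length u) (suc d))

-- Enrichment

module _ {A : Set} {k : ℕ} (p : List A → Fin k) where

  τ-from-++ : ∀ pre x y → τ-from p pre (x ++ y) ≡ τ-from p pre x ++ τ-from p (pre ++ x) y
  τ-from-++ pre []      y = cong (λ z → τ-from p z y) (sym (++-identityʳ pre))
  τ-from-++ pre (a ∷ x) y = cong ((p pre , a) ∷_) (trans (τ-from-++ (pre ++ [ a ]) x y)
    (cong (λ z → τ-from p (pre ++ [ a ]) x ++ τ-from p z y) (++-assoc pre [ a ] x)))

  τ-∷ʳ : ∀ u a → τ p (u ++ [ a ]) ≡ τ p u ++ [ p u , a ]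
  τ-∷ʳ u a = τ-from-++ [] u [ a ]

  -- Agreement is required after every continuation because the context grows with each letter read.
  τ-from-cong : ∀ {pre pre'} → (∀ w → p (pre ++ w) ≡ p (pre' ++ w)) →
    ∀ x → τ-from p pre x ≡ τ-from p pre' x
  τ-from-cong same []      = refl
  τ-from-cong {pre} {pre'} same (a ∷ x) = cong₂ (λ i z → (i , a) ∷ z)
    (trans (cong p (sym (++-identityʳ pre))) (trans (same []) (cong p (++-identityʳ pre'))))
    (τ-from-cong (λ w → trans (cong p (++-assoc pre [ a ] w))
      (trans (same (a ∷ w)) (cong p (sym (++-assoc pre' [ a ] w))))) x)

  map-proj₂-τ : ∀ u → map proj₂ (τ p u) ≡ u
  map-proj₂-τ = go []
    where
    go : ∀ pre u → map proj₂ (τ-from p pre u) ≡ u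
    go pre []      = refl
    go pre (a ∷ u) = cong (a ∷_) (go (pre ++ [ a ]) u)

  concatMap-τ-∷ʳ : (g : Fin k × A → List Y) → ∀ u a →
    concatMap g (τ p (u ++ [ a ])) ≡ concatMap g (τ p u) ++ g (p u , a)
  concatMap-τ-∷ʳ g u a = begin
    concatMap g (τ p (u ++ [ a ]))              ≡⟨ cong (concatMap g) (τ-∷ʳ u a) ⟩
    concatMap g (τ p u ++ [ p u , a ])          ≡⟨ concatMap-++ g (τ p u) [ p u , a ] ⟩
    concatMap g (τ p u) ++ (g (p u , a) ++ [])  ≡⟨ cong (concatMap g (τ p u) ++_) (++-identityʳ _) ⟩
    concatMap g (τ p u) ++ g (p u , a) ∎

  -- A function computed from left to right is a morphism after enrichment as soon as its increment
  -- at each letter depends only on that letter and the class of the prefix.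
  concatMap-τ : (T : List A → List Y) (g : Fin k × A → List Y) → T [] ≡ [] →
    (∀ u a → T (u ++ [ a ]) ≡ T u ++ g (p u , a)) → ∀ u → concatMap g (τ p u) ≡ T u
  concatMap-τ T g T[] step u = go (reverseView u)
    where
    go : ∀ {u} → Reverse u → concatMap g (τ p u) ≡ T u
    go []           = sym T[]
    go (u ∶ r ∶ʳ a) = trans (concatMap-τ-∷ʳ g u a) (trans (cong (_++ _) (go r)) (sym (step u a)))

-- Blocks are disjoint, so the index in the union can only be `p u`.
enriched-∈ : ∀ {C D L} (E : Enriched C D A L) → let open Enriched E in L ≐ (λ u → Lp (p u) (τ p u))
enriched-∈ E u = mk⇔ (λ x → let i , y , eq = to (decomp u) x in subst (λ j → Lp j (τ p u)) (sym eq) y)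
                      (λ x → from (decomp u) (p u , x , refl))
  where open Enriched E

module _ {C : Class} {A : Set} (fin : Finite A) (P : SuffixPartition A n) where
  open SuffixPartition P

  enriched-by-suffix : (Lp : Fin size → Lang (Fin size × A)) → (∀ i → C _ (Lp i)) →
    (C ∘ᶜ SU) A (λ u → Lp (class u) (τ class u))
  enriched-by-suffix Lp LpC = record
    { k        = size
    ; p        = class
    ; blocksD  = SufDet⇒SU-blocks fin class determined
    ; nonempty = λ i → word i , class-word i
    ; Lp       = Lp
    ; LpC      = LpC
    ; decomp   = λ u → mk⇔ (λ x → class u , x , refl) (λ { (_ , x , refl) → x })
    }

-- Block abstraction

letters : Block A d → List A
letters (_ , v) = toList v

flat : List (Block A d) → List A
flat = concatMap letters

Full : Block A d → Set
Full {d = d} b = length (letters b) ≡ suc d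

-- The greedy reader stops for one of two reasons, matching the two alternatives: the block has
-- reached its full length, or the input is exhausted.
takeBlock-letters : ∀ d (l : Fin (suc d)) (a : A) (v : Vec A (toℕ l)) r → Full {d = d} (l , a ∷ v) ⊎ r ≡ [] →
  takeBlock d a (toList v ++ r) ≡ ((l , a ∷ v) , r)
takeBlock-letters zero    fzero    a []      r         _             = refl
takeBlock-letters (suc d) fzero    a []      []        _             = refl
takeBlock-letters (suc d) fzero    a []      (_ ∷ _)   (inj₁ ())
takeBlock-letters (suc d) fzero    a []      (_ ∷ _)   (inj₂ ())
takeBlock-letters (suc d) (fsuc l) a (b ∷ v) r         h
  rewrite takeBlock-letters d l b v r (Sum.map₁ suc-injective h) = refl

block-of : ∀ (a : A) x → length x ≤ d → Σ (Block A d) λ b → letters b ≡ a ∷ x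
block-of a []      _         = (fzero , a ∷ []) , refl
block-of a (b ∷ x) (s≤s x≤d) with block-of b x x≤d
... | (l , v) , eq = (fsuc l , a ∷ v) , cong (a ∷_) eq

-- The image of μ: all blocks but the last have full length.
data Cut {A : Set} {d : ℕ} : List (Block A d) → Set where
  []  : Cut []
  last : ∀ b → Cut [ b ]
  _∷_ : ∀ {b W} → Full b → Cut W → Cut (b ∷ W)

Cut-full : {W : List (Block A d)} → All Full W → Cut W
Cut-full []       = []
Cut-full (f ∷ fs) = f ∷ Cut-full fs

Cut-∷ʳ : {W : List (Block A d)} → All Full W → ∀ b → Cut (W ++ [ b ])
Cut-∷ʳ []       b = last b
Cut-∷ʳ (f ∷ fs) b = f ∷ Cut-∷ʳ fs b

μ-flat : {W : List (Block A d)} → Cut W → μ d (flat W) ≡ W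
μ-flat cut = go cut ≤-refl
  where
  -- Generalised to any sufficient fuel. Every block has a letter, so fuel cannot run out before the
  -- blocks do.
  go : ∀ {W : List (Block A d)} {f} → Cut W → length (flat W) ≤ f → blocks d f (flat W) ≡ W
  go {f = zero}  []      _ = refl
  go {f = suc f} []      _ = refl
  go {f = zero}  (last (_ , _ ∷ _)) ()
  go {W = (_ , _ ∷ _) ∷ _} {f = zero} (_ ∷ _) ()
  go {d = d} {f = suc f} (last (l , a ∷ v)) (s≤s _)
    rewrite takeBlock-letters d l a v [] (inj₂ refl) = cong (_ ∷_) (go {f = f} [] z≤n)
  go {d = d} {W = (l , a ∷ v) ∷ W} {f = suc f} (full ∷ cut) (s≤s le)
    rewrite takeBlock-letters d l a v (flat W) (inj₁ full) =
    cong (_ ∷_) (go cut (≤-trans (length-++-≤ʳ (flat W) {toList v}) le))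

-- Decomposition into full blocks and a remainder

record Split {A : Set} (d : ℕ) (u : List A) : Set where
  constructor split
  field
    full      : List (Block A d)
    remainder : List A
    all-full  : All Full full
    short     : length remainder ≤ d
    join      : u ≡ flat full ++ remainder

flat-∷ʳ : (W : List (Block A d)) (b : Block A d) → flat (W ++ [ b ]) ≡ flat W ++ letters b
flat-∷ʳ W b = trans (concatMap-++ letters W [ b ]) (cong (flat W ++_) (++-identityʳ (letters b)))

length-∷ʳ : (x : List A) (a : A) → length (x ++ [ a ]) ≡ suc (length x)
length-∷ʳ x a = trans (length-++ x) (+-comm (length x) 1)

close-block : (x : List A) (a : A) → length x ≤ d → Σ (Block A d) λ b → letters b ≡ x ++ [ a ]
close-block []      a _   = block-of a [] z≤n
close-block (c ∷ x) a x≤d = block-of c (x ++ [ a ]) (≤-trans (≤-reflexive (length-∷ʳ x a)) x≤d)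

close-full : {b : Block A d} {x : List A} {a : A} → letters b ≡ x ++ [ a ] → length x ≡ d → Full b
close-full {x = x} {a} eq x≡d = trans (cong length eq) (trans (length-∷ʳ x a) (cong suc x≡d))

flat-close : {W : List (Block A d)} {b : Block A d} {x y : List A} →
  letters b ≡ x ++ y → flat (W ++ [ b ]) ≡ (flat W ++ x) ++ y
flat-close {W = W} {b} {x} {y} eq =
  trans (flat-∷ʳ W b) (trans (cong (flat W ++_) eq) (sym (++-assoc (flat W) x y)))

-- Induction on the right end of the word: a new letter either lengthens the remainder or, when the
-- remainder already has `d` letters, completes a block of length `suc d`. The split is built
-- together with the property.
split-induction : (P : List (Block A d) → List A → Set) → P [] [] →
  (∀ {W x} a → All Full W → length x < d → P W x → P W (x ++ [ a ])) →
  (∀ {W x} a b → All Full W → length x ≡ d → letters b ≡ x ++ [ a ] → P W x → P (W ++ [ b ]) []) →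
  ∀ u → Σ (Split d u) λ s → P (Split.full s) (Split.remainder s)
split-induction {d = d} P base grow close u = go (reverseView u)
  where
  go : ∀ {u} → Reverse u → Σ (Split d u) λ s → P (Split.full s) (Split.remainder s)
  go [] = split [] [] [] z≤n refl , base
  go (u ∶ r ∶ʳ a) with go r
  ... | split W x fs x≤d eq , h with length x ≟ d
  ... | yes x≡d = let b , lb = close-block x a x≤d in
    split (W ++ [ b ]) [] (All.++⁺ fs (close-full {b = b} lb x≡d ∷ [])) z≤n
      (trans (cong (_++ [ a ]) eq) (trans (sym (flat-close {W = W} {b} lb)) (sym (++-identityʳ _)))) ,
    close a b fs x≡d lb h
  ... | no x≢d = let x<d = ≤∧≢⇒< x≤d x≢d in
    split W (x ++ [ a ]) fs (≤-trans (≤-reflexive (length-∷ʳ x a)) x<d)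
      (trans (cong (_++ [ a ]) eq) (++-assoc (flat W) x [ a ])) ,
    grow a fs x<d h

flat-cover : ∀ d (u : List A) → ∃ λ (W : List (Block A d)) → Cut W × flat W ≡ u
flat-cover d u with split-induction {d = d} (λ _ _ → ⊤) tt (λ _ _ _ _ → tt) (λ _ _ _ _ _ _ → tt) u
... | split W []      fs _   refl , _ = W , Cut-full fs , sym (++-identityʳ (flat W))
... | split W (c ∷ x) fs x≤d refl , _ = let b , lb = block-of c x (<⇒≤ x≤d) in
  W ++ [ b ] , Cut-∷ʳ fs b , trans (flat-∷ʳ W b) (cong (flat W ++_) lb)

-- Every word is the flattening of some cut sequence, and `μ` recovers that sequence by `μ-flat`.
μ-spec : ∀ d (u : List A) → Cut (μ d u) × flat (μ d u) ≡ u
μ-spec d u with flat-cover d u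
... | W , cut , refl = subst Cut (sym (μ-flat cut)) cut , cong flat (μ-flat cut)

length-flat : {W : List (Block A d)} → All Full W → length (flat W) ≡ length W * suc d
length-flat []                 = refl
length-flat {W = b ∷ W} (f ∷ fs) = trans (length-++ (letters b)) (cong₂ _+_ f (length-flat fs))

length-full-% : {W : List (Block A d)} → All Full W → ∀ w → length (flat W ++ w) % suc d ≡ length w % suc d
length-full-% {d = d} {W} fs w = begin
  length (flat W ++ w) % suc d           ≡⟨ cong (_% suc d) (trans (length-++ (flat W)) (+-comm (length (flat W)) _)) ⟩
  (length w + length (flat W)) % suc d   ≡⟨ cong (λ l → (length w + l) % suc d) (length-flat fs) ⟩
  (length w + length W * suc d) % suc d  ≡⟨ [m+kn]%n≡m%n (length w) (length W) (suc d) ⟩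
  length w % suc d ∎

drop-flat : {W : List (Block A d)} → All Full W → ∀ c x → c ≤ length W →
  drop (c * suc d) (flat W ++ x) ≡ flat (drop c W) ++ x
drop-flat fs zero x _ = refl
drop-flat {d = d} {W = b ∷ W} (f ∷ fs) (suc c) x (s≤s c≤W) = begin
  drop (suc d + c * suc d) ((letters b ++ flat W) ++ x)
    ≡⟨ cong₂ (λ l z → drop (l + c * suc d) z) (sym f) (++-assoc (letters b) (flat W) x) ⟩
  drop (length (letters b) + c * suc d) (letters b ++ (flat W ++ x))
    ≡⟨ drop-length-++ (letters b) (flat W ++ x) (c * suc d) ⟩
  drop (c * suc d) (flat W ++ x)
    ≡⟨ drop-flat fs c x c≤W ⟩
  flat (drop c W) ++ x ∎

-- Keeping `n` block lengths beyond the remainder places the left end of the suffix at a block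
-- boundary.
suffix-flat : ∀ n {W : List (Block A d)} → All Full W → ∀ x →
  suffix (n * suc d + length x) (flat W ++ x) ≡ flat (suffix n W) ++ x
suffix-flat {d = d} n {W} fs x = begin
  drop (length (flat W ++ x) ∸ (n * suc d + length x)) (flat W ++ x)
    ≡⟨ cong (λ l → drop l (flat W ++ x)) count ⟩
  drop ((length W ∸ n) * suc d) (flat W ++ x)
    ≡⟨ drop-flat fs (length W ∸ n) x (m∸n≤m (length W) n) ⟩
  flat (suffix n W) ++ x ∎
  where
  -- Truncated subtraction distributes over multiplication, so the case of fewer than `n` blocks is
  -- covered too.
  count : length (flat W ++ x) ∸ (n * suc d + length x) ≡ (length W ∸ n) * suc d
  count = begin
    length (flat W ++ x) ∸ (n * suc d + length x)
      ≡⟨ cong (_∸ (n * suc d + length x)) (trans (length-++ (flat W)) (cong (_+ length x) (length-flat fs))) ⟩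
    length W * suc d + length x ∸ (n * suc d + length x)
      ≡⟨ cong₂ _∸_ (+-comm (length W * suc d) (length x)) (+-comm (n * suc d) (length x)) ⟩
    length x + length W * suc d ∸ (length x + n * suc d)
      ≡⟨ [m+n]∸[m+o]≡n∸o (length x) (length W * suc d) (n * suc d) ⟩
    length W * suc d ∸ n * suc d
      ≡⟨ *-distribʳ-∸ (suc d) (length W) n ⟨
    (length W ∸ n) * suc d ∎

suffix-full : ∀ n {W : List (Block A d)} → All Full W → All Full (suffix n W)
suffix-full n {W} fs = All.drop⁺ (length W ∸ n) fs

-- Both inclusions

upper-bound : (f : Fin k → ℕ) → ∃ λ m → ∀ i → f i ≤ m
upper-bound {zero}  f = 0 , λ ()
upper-bound {suc k} f = let m , f≤m = upper-bound (f ∘ fsuc) in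
  f fzero ⊔ m , λ { fzero → m≤m⊔n _ m ; (fsuc i) → ≤-trans (f≤m i) (m≤n⊔m (f fzero) m) }

length-concatMap-≥ : (h : A → List B) → (∀ a → 1 ≤ length (h a)) → ∀ w → length w ≤ length (concatMap h w)
length-concatMap-≥ h ne []      = z≤n
length-concatMap-≥ h ne (a ∷ w) =
  ≤-trans (+-mono-≤ (ne a) (length-concatMap-≥ h ne w)) (≤-reflexive (sym (length-++ (h a))))

SufDet-concatMap : {f : List B → Y} (h : A → List B) → (∀ a → 1 ≤ length (h a)) →
  SufDet n f → SufDet n (f ∘ concatMap h)
SufDet-concatMap {f = f} h ne det u w n≤w = trans (cong f (concatMap-++ h u w))
  (det (concatMap h u) (concatMap h w) (≤-trans n≤w (length-concatMap-≥ h ne w)))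

-- Extending two contexts by the same word preserves their long common suffix, so all labels along
-- `x` agree.
SufDet-τ-from : {p : List A → Fin k} → SufDet n p → ∀ x → SufDet n (λ pre → τ-from p pre x)
SufDet-τ-from {p = p} det x u w n≤w = τ-from-cong p (λ v → SufDet-++ v det u w n≤w) x

-- From the length enrichment to block abstraction

module Forward {C : Class} (V : PositiveVariety C) {A : Set} (fin : Finite A) {L : Lang A}
  (E : ((C ∘ᶜ SU) ∘ᶜ MOD) A L) (d : ℕ)
  (p-periodic : ∀ {u v} → SameLength% d u v → Enriched.p E u ≡ Enriched.p E v) (m : ℕ)
  (inner-det : ∀ i → SufDet (suc m) (Enriched.p (Enriched.LpC E i)))
  (P : SuffixPartition (Block A d) (suc m)) where

  open Enriched E renaming (k to #p)
  open SuffixPartition P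
  module Inner (i : Fin #p) = Enriched (LpC i)

  p-full : (b : Block A d) → Full b → ∀ w → p (letters b ++ w) ≡ p w
  p-full b full w = p-periodic {letters b ++ w} {w} (trans
    (cong (λ z → length z % suc d) (cong (_++ w) (sym (++-identityʳ (letters b)))))
    (length-full-% {W = [ b ]} (full ∷ []) w))

  h : Block A d → List (Fin #p × A)
  h b = τ p (letters b)

  1≤h : ∀ b → 1 ≤ length (h b)
  1≤h (_ , _ ∷ _) = s≤s z≤n

  -- By periodicity, labels restart after each full block. Only the last block may be incomplete,
  -- and nothing follows it.
  τ-flat : ∀ {W} → Cut W → τ p (flat W) ≡ concatMap h W
  τ-flat [] = refl
  τ-flat (last b) = trans (cong (τ p) (++-identityʳ (letters b))) (sym (++-identityʳ (h b)))
  τ-flat {b ∷ W} (full ∷ cut) = trans (τ-from-++ p [] (letters b) (flat W))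
    (cong (h b ++_) (trans (τ-from-cong p (p-full b full) (flat W)) (τ-flat cut)))

  lastClass : List (Block A d) → Fin #p
  lastClass W = p (flat (suffix 1 W))

  -- Removing full blocks from the front does not change the length modulo `suc d`; the empty
  -- sequence gives the class of the empty word.
  p-flat : ∀ {W} → Cut W → p (flat W) ≡ lastClass W
  p-flat []       = refl
  p-flat (last b) = refl
  p-flat {b ∷ []}    (full ∷ cut) = refl
  p-flat {b ∷ _ ∷ _} (full ∷ cut) = trans (p-full b full _) (p-flat cut)

  -- The inner labels of a block depend on what precedes it; the representative of the class `j`
  -- stands in for that past.
  g : ∀ i → Fin size × Block A d → List (Fin (Inner.k i) × (Fin #p × A))
  g i (j , b) = τ-from (Inner.p i) (concatMap h (word j)) (h b)

  g-correct : ∀ i W → concatMap (g i) (τ class W) ≡ τ (Inner.p i) (concatMap h W)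
  g-correct i = concatMap-τ class (τ (Inner.p i) ∘ concatMap h) (g i) refl λ W b → begin
    τ pᵢ (concatMap h (W ++ [ b ]))
      ≡⟨ cong (τ pᵢ) (trans (concatMap-++ h W [ b ]) (cong (concatMap h W ++_) (++-identityʳ (h b)))) ⟩
    τ pᵢ (concatMap h W ++ h b)
      ≡⟨ τ-from-++ pᵢ [] (concatMap h W) (h b) ⟩
    τ pᵢ (concatMap h W) ++ τ-from pᵢ (concatMap h W) (h b)
      ≡⟨ cong (τ pᵢ (concatMap h W) ++_)
           (word-class (SufDet-concatMap h 1≤h (SufDet-τ-from (inner-det i) (h b))) W) ⟨
    τ pᵢ (concatMap h W) ++ g i (class W , b) ∎
    where
    pᵢ = Inner.p i

  -- Both the outer class `i` and the inner block are read off `j`, so each `Kp j` is the inverse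
  -- image of one fixed language under one fixed morphism.
  Kp : Fin size → Lang (Fin size × Block A d)
  Kp j z = Inner.Lp i (Inner.p i (concatMap h (word j))) (concatMap (g i) z)
    where i = lastClass (word j)

  KpC : ∀ j → C _ (Kp j)
  KpC j = PositiveVariety.inverse V (Finite-× Finite-Fin (Finite-Block fin d))
    (Finite-× Finite-Fin (Finite-× Finite-Fin fin)) (Inner.LpC i _) (g i)
    where i = lastClass (word j)

  K : Lang (Block A d)
  K W = Kp (class W) (τ class W)

  K-correct : ∀ {W} → Cut W → K W ≡ Inner.Lp (p (flat W)) (Inner.p _ (τ p (flat W))) (τ (Inner.p _) (τ p (flat W)))
  K-correct {W} cut = begin
    K W
      ≡⟨ cong (λ i → Inner.Lp i (Inner.p i (concatMap h (word (class W)))) (concatMap (g i) (τ class W)))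
           (trans (word-class (SufDet-≤ (s≤s z≤n) (SufDet-∘ (p ∘ flat) (SufDet-suffix 1))) W) (sym (p-flat cut))) ⟩
    Inner.Lp i (Inner.p i (concatMap h (word (class W)))) (concatMap (g i) (τ class W))
      ≡⟨ cong₂ (Inner.Lp i) (word-class (SufDet-concatMap h 1≤h (inner-det i)) W) (g-correct i W) ⟩
    Inner.Lp i (Inner.p i (concatMap h W)) (τ (Inner.p i) (concatMap h W))
      ≡⟨ cong (λ x → Inner.Lp i (Inner.p i x) (τ (Inner.p i) x)) (τ-flat cut) ⟨
    Inner.Lp i (Inner.p i (τ p (flat W))) (τ (Inner.p i) (τ p (flat W))) ∎
    where i = p (flat W)

  blockAbs : BlockAbs (C ∘ᶜ SU) A L
  blockAbs = mkBA d K (enriched-by-suffix {C = C} (Finite-Block fin d) P Kp KpC) L≐K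
    where
    L≐K : L ≐ (λ u → K (μ d u))
    L≐K u with μ-spec d u
    ... | cut , eq = mk⇔ (subst id (sym K≡) ∘ to inner ∘ to outer) (from outer ∘ from inner ∘ subst id K≡)
      where
      outer = enriched-∈ E u
      inner = enriched-∈ (LpC (p u)) (τ p u)
      K≡ : K (μ d u) ≡ Inner.Lp (p u) (Inner.p _ (τ p u)) (τ (Inner.p _) (τ p u))
      K≡ = subst (λ v → K (μ d u) ≡ Inner.Lp (p v) (Inner.p _ (τ p v)) (τ (Inner.p _) (τ p v))) eq (K-correct cut)

forward : ∀ {C} → PositiveVariety C → Finite A → ∀ {L} → ((C ∘ᶜ SU) ∘ᶜ MOD) A L → BlockAbs (C ∘ᶜ SU) A L
forward V fin E =
  let d , per   = MOD-blocks⇒periodic p blocksD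
      m , bound = upper-bound (λ i → proj₁ (inner i))
  in Forward.blockAbs V fin E d per m
       -- The suffix length is one more than the common bound, hence at least 1: it must also reveal
       -- the last block, which gives the outer class.
       (λ i → SufDet-≤ (m≤n⇒m≤1+n (bound i)) (proj₂ (inner i)))
       (suffixPartition (Finite-Block fin d) (suc m))
  where
  open Enriched E
  inner : ∀ i → ∃ λ n → SufDet n (Enriched.p (LpC i))
  inner i = SU-blocks⇒SufDet (Enriched.p (LpC i)) (Enriched.blocksD (LpC i))

-- From block abstraction to the length enrichment

module Backward {C : Class} (V : PositiveVariety C) {A : Set} (fin : Finite A) (d : ℕ)
  {K : Lang (Block A d)} (E : (C ∘ᶜ SU) (Block A d) K) (n : ℕ) (q-det : SufDet n (Enriched.p E))
  (Q : LengthPartition A d) (P : SuffixPartition (Fin (LengthPartition.size Q) × A) (n * suc d + d)) where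

  open Enriched E using (Lp; LpC) renaming (k to #q; p to q)

  open SuffixPartition P
  module Q = LengthPartition Q

  p : List A → Fin Q.size
  p = Q.class

  finX : Finite (Fin Q.size × A)
  finX = Finite-× Finite-Fin fin

  window : ℕ → List A → List A
  window i = suffix (n * suc d + i)

  -- A list of at most one letter, empty only for the empty word, so no default letter has to be
  -- chosen.
  lastLetter : List A → List (Fin #q × Block A d)
  lastLetter v = suffix 1 (τ q (μ d v))

  emit : ∀ {Z : Set} → Dec Z → List A → A → List (Fin #q × Block A d)
  emit (yes _) v a = lastLetter (v ++ [ a ])
  emit (no _)  v a = []

  emit-yes : ∀ {Z : Set} (z? : Dec Z) → Z → ∀ v a → emit z? v a ≡ lastLetter (v ++ [ a ])
  emit-yes (yes _) _ v a = refl
  emit-yes (no ¬z) z v a = ⊥-elim (¬z z)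

  emit-no : ∀ {Z : Set} (z? : Dec Z) → ¬ Z → ∀ v a → emit z? v a ≡ []
  emit-no (yes z) ¬z v a = ⊥-elim (¬z z)
  emit-no (no _)  _  v a = refl

  -- The prefix read so far has residue `d` exactly when the next letter `a` completes a block. The
  -- window is recovered from the representative by erasing its length labels.
  g : Fin size × (Fin Q.size × A) → List (Fin #q × Block A d)
  g (j , i , a) = emit (Q.residue i ≟ d) (window d (map proj₂ (word j))) a

  -- The last incomplete block, absent when the length is a multiple of suc d.
  end : ℕ → List A → List (Fin #q × Block A d)
  end zero    v = []
  end (suc i) v = lastLetter v

  final : ℕ → List A → List (Fin #q × Block A d) → Set
  final i v z = Lp (q (μ d v)) (z ++ end i v)

  -- Once `i` and `j` are fixed, so are the language `Lp` selected and the word appended by `end`.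
  -- What remains is a right quotient followed by an inverse image under `g`.
  Mp : Fin Q.size → Fin size → Lang (Fin size × (Fin Q.size × A))
  Mp i j z = final (Q.residue i) (window (Q.residue i) (map proj₂ (word j))) (concatMap g z)

  MpC : ∀ i j → C _ (Mp i j)
  MpC i j = inverse (Finite-× Finite-Fin finX) finKB (quotʳ finKB (LpC _) _) g
    where
    open PositiveVariety V
    finKB = Finite-× Finite-Fin (Finite-Block fin d)

  M : Fin Q.size → Lang (Fin Q.size × A)
  M i y = Mp i (class y) (τ class y)

  -- Erasing labels preserves length, and a window with `i ≤ d` fits within the suffix length of
  -- `P`.
  word-class-window : ∀ {Y : Set} {i} (f : List A → Y) → i ≤ d → ∀ u →
    f (window i (map proj₂ (word (class (τ p u))))) ≡ f (window i u)
  word-class-window {i = i} f i≤d u = trans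
    (word-class (SufDet-map proj₂ (SufDet-≤ (+-monoʳ-≤ (n * suc d) i≤d)
      (SufDet-∘ f (SufDet-suffix (n * suc d + i))))) (τ p u))
    (cong (f ∘ window i) (map-proj₂-τ p u))

  residue-split : ∀ {W x} → All Full W → length x ≤ d → Q.residue (p (flat W ++ x)) ≡ length x
  residue-split fs x≤d = trans (Q.residue-class _) (trans (length-full-% fs _) (m<n⇒m%n≡m (s≤s x≤d)))

  q-suffix : ∀ W → q (suffix n W) ≡ q W
  q-suffix = SufDet-suffix-≡ q-det

  -- The label of `b` is the class of the blocks before it, and the last `n` of them already
  -- determine that class.
  lastLetter-flat : ∀ {W} b → All Full W → lastLetter (flat (suffix n W ++ [ b ])) ≡ [ q W , b ]
  lastLetter-flat {W} b fs = begin
    suffix 1 (τ q (μ d (flat (suffix n W ++ [ b ]))))  ≡⟨ cong (suffix 1 ∘ τ q) (μ-flat (Cut-∷ʳ (suffix-full n fs) b)) ⟩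
    suffix 1 (τ q (suffix n W ++ [ b ]))               ≡⟨ cong (suffix 1) (τ-∷ʳ q (suffix n W) b) ⟩
    suffix 1 (τ q (suffix n W) ++ [ q (suffix n W) , b ])
      ≡⟨ SufDet-suffix 1 (τ q (suffix n W)) [ q (suffix n W) , b ] ≤-refl ⟩
    [ q (suffix n W) , b ]                             ≡⟨ cong (λ c → [ c , b ]) (q-suffix W) ⟩
    [ q W , b ] ∎

  window-flat : ∀ {W x} → All Full W → window (length x) (flat W ++ x) ≡ flat (suffix n W) ++ x
  window-flat {x = x} fs = suffix-flat n fs x

  output : List A → List (Fin #q × Block A d)
  output u = concatMap g (τ class (τ p u))

  output-∷ʳ : ∀ {W x} a → All Full W → length x ≤ d →
    output (flat W ++ (x ++ [ a ])) ≡ output (flat W ++ x) ++ emit (length x ≟ d) (window d (flat W ++ x)) a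
  output-∷ʳ {W} {x} a fs x≤d = begin
    output (flat W ++ (x ++ [ a ]))
      ≡⟨ cong output (++-assoc (flat W) x [ a ]) ⟨
    output (u ++ [ a ])
      ≡⟨ cong (concatMap g ∘ τ class) (τ-∷ʳ p u a) ⟩
    concatMap g (τ class (τ p u ++ [ p u , a ]))
      ≡⟨ concatMap-τ-∷ʳ class g (τ p u) (p u , a) ⟩
    output u ++ g (class (τ p u) , p u , a)
      ≡⟨ cong (output u ++_) (trans (word-class-window (λ v → emit (Q.residue (p u) ≟ d) v a) ≤-refl u)
           (cong (λ i → emit (i ≟ d) (window d u) a) (residue-split fs x≤d))) ⟩
    output u ++ emit (length x ≟ d) (window d u) a ∎
    where u = flat W ++ x

  -- Letters of an unfinished block emit nothing; the letter closing a block emits it with its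
  -- label.
  output-split : ∀ u → Σ (Split d u) λ s →
    output (flat (Split.full s) ++ Split.remainder s) ≡ τ q (Split.full s)
  output-split = split-induction (λ W x → output (flat W ++ x) ≡ τ q W) refl grow close
    where
    grow : ∀ {W x} a → All Full W → length x < d → output (flat W ++ x) ≡ τ q W →
      output (flat W ++ (x ++ [ a ])) ≡ τ q W
    grow {W} {x} a fs x<d ih = begin
      output (flat W ++ (x ++ [ a ]))
        ≡⟨ output-∷ʳ a fs (<⇒≤ x<d) ⟩
      output (flat W ++ x) ++ emit (length x ≟ d) (window d (flat W ++ x)) a
        ≡⟨ cong₂ _++_ ih (emit-no (length x ≟ d) (<⇒≢ x<d) (window d (flat W ++ x)) a) ⟩
      τ q W ++ []
        ≡⟨ ++-identityʳ (τ q W) ⟩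
      τ q W ∎
    close : ∀ {W x} a b → All Full W → length x ≡ d → letters b ≡ x ++ [ a ] → output (flat W ++ x) ≡ τ q W →
      output (flat (W ++ [ b ]) ++ []) ≡ τ q (W ++ [ b ])
    close {W} {x} a b fs x≡d lb ih = begin
      output (flat (W ++ [ b ]) ++ [])
        ≡⟨ cong output (trans (++-identityʳ _) (trans (flat-∷ʳ W b) (cong (flat W ++_) lb))) ⟩
      output (flat W ++ (x ++ [ a ]))
        ≡⟨ output-∷ʳ a fs (≤-reflexive x≡d) ⟩
      output (flat W ++ x) ++ emit (length x ≟ d) (window d (flat W ++ x)) a
        ≡⟨ cong (output (flat W ++ x) ++_) (emit-yes (length x ≟ d) x≡d (window d (flat W ++ x)) a) ⟩
      output (flat W ++ x) ++ lastLetter (window d (flat W ++ x) ++ [ a ])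
        -- Since `length x` is `d`, the window starts at a block boundary and, with `a` appended,
        -- ends with the complete block `b`.
        ≡⟨ cong₂ (λ y v → y ++ lastLetter v) ih (begin
             window d (flat W ++ x) ++ [ a ]           ≡⟨ cong (λ i → window i (flat W ++ x) ++ [ a ]) x≡d ⟨
             window (length x) (flat W ++ x) ++ [ a ]  ≡⟨ cong (_++ [ a ]) (window-flat fs) ⟩
             (flat (suffix n W) ++ x) ++ [ a ]         ≡⟨ flat-close {W = suffix n W} {b} lb ⟨
             flat (suffix n W ++ [ b ]) ∎) ⟩
      τ q W ++ lastLetter (flat (suffix n W ++ [ b ]))
        ≡⟨ cong (τ q W ++_) (lastLetter-flat b fs) ⟩
      τ q W ++ [ q W , b ]
        ≡⟨ τ-∷ʳ q W b ⟨
      τ q (W ++ [ b ]) ∎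

  -- With an empty remainder the full blocks are all of `μ`. Otherwise the remainder is one more
  -- block, whose labelled letter is what `end` supplies.
  final-split : ∀ {W} x → All Full W → length x ≤ d → output (flat W ++ x) ≡ τ q W →
    final (length x) (flat (suffix n W) ++ x) (output (flat W ++ x))
    ≡ Lp (q (μ d (flat W ++ x))) (τ q (μ d (flat W ++ x)))
  final-split {W} [] fs _ eq = cong₂ Lp
    (trans (cong q (μ-full (suffix-full n fs))) (trans (q-suffix W) (cong q (sym (μ-full fs)))))
    (trans (++-identityʳ _) (trans eq (cong (τ q) (sym (μ-full fs)))))
    where
    μ-full : ∀ {W} → All Full W → μ d (flat W ++ []) ≡ W
    μ-full fs = trans (cong (μ d) (++-identityʳ _)) (μ-flat (Cut-full fs))
  final-split {W} (c ∷ x) fs x≤d eq with block-of c x (<⇒≤ x≤d)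
  ... | b , lb = cong₂ Lp
    (trans (cong q (μ-last (suffix-full n fs)))
      (trans (SufDet-suffix-≡ (SufDet-++ [ b ] q-det) W) (cong q (sym (μ-last fs)))))
    (begin
      output (flat W ++ c ∷ x) ++ lastLetter (flat (suffix n W) ++ c ∷ x)
        ≡⟨ cong₂ (λ y v → y ++ lastLetter v) eq (sym (flat-last (suffix n W))) ⟩
      τ q W ++ lastLetter (flat (suffix n W ++ [ b ]))  ≡⟨ cong (τ q W ++_) (lastLetter-flat b fs) ⟩
      τ q W ++ [ q W , b ]                              ≡⟨ τ-∷ʳ q W b ⟨
      τ q (W ++ [ b ])                                  ≡⟨ cong (τ q) (μ-last fs) ⟨
      τ q (μ d (flat W ++ c ∷ x)) ∎)
    where
    flat-last : ∀ W → flat (W ++ [ b ]) ≡ flat W ++ c ∷ x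
    flat-last W = trans (flat-∷ʳ W b) (cong (flat W ++_) lb)
    μ-last : ∀ {W} → All Full W → μ d (flat W ++ c ∷ x) ≡ W ++ [ b ]
    μ-last {W} fs = trans (cong (μ d) (sym (flat-last W))) (μ-flat (Cut-∷ʳ fs b))

  M-correct : ∀ u → M (p u) (τ p u) ≡ Lp (q (μ d u)) (τ q (μ d u))
  M-correct u with output-split u
  ... | split W x fs x≤d refl , eq = begin
    M (p u) (τ p u)
      -- The class selecting `Lp` and the appended word both depend on the window only, so the pair
      -- is transferred from the representative at once.
      ≡⟨ cong (λ (c , e) → Lp c (output u ++ e))
           (word-class-window (λ v → q (μ d v) , end (Q.residue (p u)) v) (Q.residue≤ (p u)) u) ⟩
    final (Q.residue (p u)) (window (Q.residue (p u)) u) (output u)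
      ≡⟨ cong (λ i → final i (window i u) (output u)) (residue-split fs x≤d) ⟩
    final (length x) (window (length x) u) (output u)
      ≡⟨ cong (λ v → final (length x) v (output u)) (window-flat {W} {x} fs) ⟩
    final (length x) (flat (suffix n W) ++ x) (output u)
      ≡⟨ final-split x fs x≤d eq ⟩
    Lp (q (μ d u)) (τ q (μ d u)) ∎

  enriched : {L : Lang A} → L ≐ (λ u → K (μ d u)) → ((C ∘ᶜ SU) ∘ᶜ MOD) A L
  enriched L≐K = record
    { k        = Q.size
    ; p        = p
    ; blocksD  = Q.MOD-blocks
    ; nonempty = Q.nonempty
    ; Lp       = M
    ; LpC      = λ i → enriched-by-suffix {C = C} finX P (Mp i) (MpC i)
    ; decomp   = λ u → let E∈ = enriched-∈ E (μ d u) in mk⇔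
        (λ x → p u , subst id (sym (M-correct u)) (to E∈ (to (L≐K u) x)) , refl)
        (λ { (_ , x , refl) → from (L≐K u) (from E∈ (subst id (M-correct u) x)) })
    }

backward : ∀ {C} → PositiveVariety C → Finite A → ∀ {L} → BlockAbs (C ∘ᶜ SU) A L → ((C ∘ᶜ SU) ∘ᶜ MOD) A L
backward V fin (mkBA d _ E L≐K) =
  let n , det = SU-blocks⇒SufDet (Enriched.p E) (Enriched.blocksD E)
      Q       = lengthPartition fin d
  -- The suffix length is that of the longest window: `n` full blocks and a remainder of at most `d`
  -- letters.
  in Backward.enriched V fin d E n det Q (suffixPartition (Finite-× Finite-Fin fin) (n * suc d + d)) L≐K

theorem6p6 : (C : Class) → PositiveVariety C →
    ∀ (A : Set) → Finite A → (L : Lang A) →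
    ((C ∘ᶜ SU) ∘ᶜ MOD) A L ⇔ BlockAbs (C ∘ᶜ SU) A L
theorem6p6 C V A fin L = mk⇔ (forward V fin) (backward V fin)
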